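{- Let $S:\mathbb{N}^{\mathbb{N}}\to\mathbb{N}^{\mathbb{N}}$ be the function with $S(\alpha)(n)=n+1$ if $n+1\notin\mathrm{im}(\alpha)$ and $S(\alpha)(n)=0$ otherwise. (a) The set $\mathbb{N}^{\mathbb{N}}$ cannot be written as a countable union $\bigcup_{i\in\mathbb{N}}V_i$ such that $S$ is continuous on each $V_i$ for the Baire space topology (i.e. each restriction $S|_{V_i}:V_i\to\mathbb{N}^{\mathbb{N}}$ is continuous, $V_i$ having the subspace topology). (b) The function $S$ is, relative to Kleene's second model $\mathcal{K}_2$, not computable in any function $F:\mathbb{N}^{\mathbb{N}}\to\mathbb{N}^{\mathbb{N}}$ with countable image; i.e. for every such $F$, $S$ is not representable in $\mathcal{K}_2[F]$.
   Context: A partial combinatory algebra (pca) is a set $\mathcal{A}$ with a partial binary application $(a,b)\mapsto ab$ (associating to the left) such that there are $\mathsf{k},\mathsf{s}\in\mathcal{A}$ with, for all $a,b,c$: $\mathsf{k}ab=a$; $\mathsf{s}ab$ is defined; and whenever $(ac)(bc)$ is defined, $\mathsf{s}abc$ is defined and equals $(ac)(bc)$. A partial function $f:\mathcal{A}\to\mathcal{A}$ is representable in $\mathcal{A}$ if there is $a_f\in\mathcal{A}$ with $a_fa=f(a)$ for all $a$ in the domain of $f$. Every pca contains booleans $\mathsf{T},\mathsf{F}$ with a definition-by-cases element $D$ ($D\mathsf{T}ab=a$, $D\mathsf{F}ab=b$), and standard codings $[a,b]$ of pairs and $[a_0,\ldots,a_{n-1}]$ of finite sequences whose basic operations (length, projections,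 appending) are representable; fix such choices. For a pca $\mathcal{A}$ and a partial function $f:\mathcal{A}\to\mathcal{A}$, $\mathcal{A}[f]$ is the pca with underlying set $\mathcal{A}$ and application $\cdot_f$ defined by: $a\cdot_f b=c$ iff there is a finite sequence $e_0,\ldots,e_{n-1}$ in $\mathcal{A}$ (on each of which $f$ is defined) such that $a[b,f(e_0),\ldots,f(e_{i-1})]=[\mathsf{F},e_i]$ for all $i<n$ and $a[b,f(e_0),\ldots,f(e_{n-1})]=[\mathsf{T},c]$. $\mathcal{K}_2$ (Kleene's second model): underlying set $\mathbb{N}^{\mathbb{N}}$; $\alpha\beta$ is defined iff for every $n$ there is $k$ with $\alpha([n,\beta(0),\ldots,\beta(k-1)])>0$ (with $[\cdot,\ldots,\cdot]$ a standard coding of finite sequences of naturals by naturals), and then $(\alpha\beta)(n)=\alpha([n,\beta(0),\ldots,\beta(k-1)])-1$ for the least such $k$. The Baire space topology on $\mathbb{N}^{\mathbb{N}}$ is the product topology of discrete copies of $\mathbb{N}$. It is well known that a partial function on $\mathbb{N}^{\mathbb{N}}$ is representable in $\mathcal{K}_2$ iff it is continuous on its domain. -}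

module Defs where

open import Level using (0ℓ)
open import Axiom.ExcludedMiddle using (ExcludedMiddle)
open import Data.Bool.Base using (Bool; true; false; if_then_else_)
open import Data.Fin.Base using (Fin; zero; suc; toℕ)
open import Data.List.Base using (List; []; _∷_; _∷ʳ_; length; lookup; applyUpTo)
open import Data.List.Properties using (length-++)
open import Data.List.Relation.Binary.Pointwise.Base using (Pointwise; []; _∷_)
open import Data.List.Relation.Unary.All using (All)
open import Data.Maybe.Base using (Maybe; just; nothing)
open import Data.Nat.Base
  using (ℕ; zero; suc; pred; _+_; _<_; _≤_; _⊔_; _≡ᵇ_; z≤n; s≤s)
open import Data.Nat.Properties
  using (+-identityʳ; +-suc; +-comm; ≤-refl; ≤-trans
        ; m≤n+m; m≤m⊔n; m≤n⊔m; m≤n⇒m<n∨m≡n; <-cmp; 0≢1+n; suc-injective)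
open import Data.Product.Base using (_×_; _,_; proj₁; proj₂; ∃-syntax; Σ-syntax)
open import Data.Sum.Base using (_⊎_; inj₁; inj₂)
open import Data.Vec.Base as Vec using (Vec; []; _∷_)
open import Function.Base using (_∘_; const; id)
open import Function.Bundles using (Func; _⇔_; mk⇔)
open import Relation.Binary.Bundles using (Setoid)
open import Relation.Binary.Definitions using (tri<; tri≈; tri>)
open import Relation.Binary.PropositionalEquality
  using (_≡_; _≗_; refl; sym; trans; cong; cong₂; _→-setoid_)
open import Relation.Nullary.Decidable using (does; does-⇔)
open import Relation.Nullary.Negation using (contradiction)
open import Relation.Unary using (Pred; _∈_)

record PartialFun (X : Setoid 0ℓ 0ℓ) : Set₁ where
  open Setoid X
  infix 4 _↦_
  field
    _↦_        : Carrier → Carrier → Set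
    resp       : ∀ {a a′ b b′} → a ≈ a′ → b ≈ b′ → a ↦ b → a′ ↦ b′
    functional : ∀ {a b b′} → a ↦ b → a ↦ b′ → b ≈ b′

total : {X : Setoid 0ℓ 0ℓ} → Func X X → PartialFun X
total {X} F = record
  { _↦_        = λ a b → to a ≈ b
  ; resp       = λ p q r → X.trans (X.sym (cong′ p)) (X.trans r q)
  ; functional = λ p q → X.trans (X.sym p) q
  }
  where
  module X = Setoid X
  open X using (_≈_)
  open Func F using (to) renaming (cong to cong′)

-- a · b ⇓ c  reads "ab is defined and equal to c".

record PAS : Set₁ where
  infix 4 _·_⇓_ _·_·_⇓_ _·_·_·_⇓_
  field
    setoid : Setoid 0ℓ 0ℓ
  open Setoid setoid public
    using (Carrier; _≈_) renaming (refl to ≈-refl; sym to ≈-sym; trans to ≈-trans)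
  field
    _·_⇓_      : Carrier → Carrier → Carrier → Set
    resp       : ∀ {a a′ b b′ c c′} → a ≈ a′ → b ≈ b′ → c ≈ c′ →
                 a · b ⇓ c → a′ · b′ ⇓ c′
    functional : ∀ {a b c c′} → a · b ⇓ c → a · b ⇓ c′ → c ≈ c′

  _·_·_⇓_ : Carrier → Carrier → Carrier → Carrier → Set
  a · b · c ⇓ d = ∃[ x ] (a · b ⇓ x) × (x · c ⇓ d)

  _·_·_·_⇓_ : Carrier → Carrier → Carrier → Carrier → Carrier → Set
  a · b · c · d ⇓ e = ∃[ x ] (a · b · c ⇓ x) × (x · d ⇓ e)

  functional₃ : ∀ {a b c d e e′} → a · b · c · d ⇓ e → a · b · c · d ⇓ e′ → e ≈ e′
  functional₃ (x , (y , p , q) , r) (x′ , (y′ , p′ , q′) , r′) =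
    functional r (resp (≈-sym x≈x′) ≈-refl ≈-refl r′)
    where x≈x′ = functional q (resp (≈-sym (functional p p′)) ≈-refl ≈-refl q′)

Representable : (A : PAS) → PartialFun (PAS.setoid A) → Set
Representable A f = ∃[ r ] ∀ a b → a ↦ b → r · a ⇓ b
  where
  open PAS A
  open PartialFun f using (_↦_)

-- A choice of booleans, pairs and finite sequences.  The numerals are only
-- there to express that length and projections are representable.

record Coding (A : PAS) : Set where
  open PAS A
  field
    T F D : Carrier
    D-T   : ∀ a b → D · T · a · b ⇓ a
    D-F   : ∀ a b → D · F · a · b ⇓ b

    pair      : Carrier → Carrier → Carrier
    pair-cong : ∀ {a a′ b b′} → a ≈ a′ → b ≈ b′ → pair a b ≈ pair a′ b′
    pairing   : ∃[ r ] ∀ a b → r · a · b ⇓ pair a b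
    fst       : ∃[ r ] ∀ a b → r · pair a b ⇓ a
    snd       : ∃[ r ] ∀ a b → r · pair a b ⇓ b

    numeral     : ℕ → Carrier
    successor   : ∃[ r ] ∀ n → r · numeral n ⇓ numeral (suc n)
    predecessor : ∃[ r ] ∀ n → r · numeral n ⇓ numeral (pred n)
    zero-test   : ∃[ r ] ∀ n → r · numeral n ⇓ (if n ≡ᵇ 0 then T else F)

    seq      : List Carrier → Carrier
    seq-cong : ∀ {as bs} → Pointwise _≈_ as bs → seq as ≈ seq bs
    seq-len  : ∃[ r ] ∀ as → r · seq as ⇓ numeral (length as)
    seq-proj : ∃[ r ] ∀ as i → r · seq as · numeral (toℕ i) ⇓ lookup as i
    append   : ∃[ r ] ∀ as b → r · seq as · b ⇓ seq (as ∷ʳ b)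

module Adjoin {A : PAS} (C : Coding A) (f : PartialFun (PAS.setoid A)) where
  open PAS A
  open Coding C
  open PartialFun f using (_↦_) renaming (resp to ↦-resp; functional to ↦-functional)

  -- The finite sequences e₀,…,eₙ₋₁ and dᵢ = f(eᵢ) are given by functions on ℕ
  -- of which only the values below n matter.
  Dialogue : Carrier → Carrier → Carrier → ℕ → (e d : ℕ → Carrier) → Set
  Dialogue a b c n e d =
    (∀ i → i < n → (e i ↦ d i) × (a · seq (b ∷ applyUpTo d i) ⇓ pair F (e i)))
    × (a · seq (b ∷ applyUpTo d n) ⇓ pair T c)

  infix 4 _·ᶠ_⇓_
  _·ᶠ_⇓_ : Carrier → Carrier → Carrier → Set
  a ·ᶠ b ⇓ c = ∃[ n ] ∃[ e ] ∃[ d ] Dialogue a b c n e d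

  private
    prefix : ∀ (d d′ : ℕ → Carrier) n → (∀ i → i < n → d i ≈ d′ i) →
             Pointwise _≈_ (applyUpTo d n) (applyUpTo d′ n)
    prefix d d′ zero    h = []
    prefix d d′ (suc n) h =
      h 0 (s≤s z≤n) ∷ prefix (d ∘ suc) (d′ ∘ suc) n λ i i<n → h (suc i) (s≤s i<n)

    pair-injectiveˡ : ∀ {a a′ b b′} → pair a b ≈ pair a′ b′ → a ≈ a′
    pair-injectiveˡ p = functional (proj₂ fst _ _) (resp ≈-refl (≈-sym p) ≈-refl (proj₂ fst _ _))

    pair-injectiveʳ : ∀ {a a′ b b′} → pair a b ≈ pair a′ b′ → b ≈ b′
    pair-injectiveʳ p = functional (proj₂ snd _ _) (resp ≈-refl (≈-sym p) ≈-refl (proj₂ snd _ _))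

    T≈F⇒trivial : T ≈ F → ∀ a b → a ≈ b
    T≈F⇒trivial p a b with D-T a b
    ... | x , (y , q , r) , s =
      functional₃ (x , (y , resp ≈-refl p ≈-refl q , r) , s) (D-F a b)

    agree : ∀ {a b c c′ n n′ e e′ d d′} →
            Dialogue a b c n e d → Dialogue a b c′ n′ e′ d′ →
            ∀ k → k ≤ n → k ≤ n′ → ∀ i → i < k → d i ≈ d′ i
    agree {d = d} {d′} p p′ (suc k) k<n k<n′ i (s≤s i≤k) with m≤n⇒m<n∨m≡n i≤k
    ... | inj₁ i<k  = agree p p′ k (≤-trans (m≤n+m k 1) k<n) (≤-trans (m≤n+m k 1) k<n′) i i<k
    ... | inj₂ refl =
      ↦-functional (proj₁ q) (↦-resp (≈-sym (pair-injectiveʳ e≈e′)) ≈-refl (proj₁ q′))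
      where
      q  = proj₁ p k k<n
      q′ = proj₁ p′ k k<n′
      ih = agree p p′ k (≤-trans (m≤n+m k 1) k<n) (≤-trans (m≤n+m k 1) k<n′)
      e≈e′ = functional (proj₂ q)
        (resp ≈-refl (seq-cong (≈-refl ∷ prefix d′ d k λ j j<k → ≈-sym (ih j j<k))) ≈-refl (proj₂ q′))

    longer : ∀ {a b c c′ n n′ e e′ d d′} → n < n′ →
             Dialogue a b c n e d → Dialogue a b c′ n′ e′ d′ → T ≈ F
    longer {n = n} {d = d} {d′} n<n′ p p′ =
      pair-injectiveˡ (functional (proj₂ p)
        (resp ≈-refl (seq-cong (≈-refl ∷ prefix d′ d n λ j j<n →
                        ≈-sym (agree p p′ n ≤-refl (≤-trans (m≤n+m n 1) n<n′) j j<n)))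
              ≈-refl (proj₂ (proj₁ p′ n n<n′))))

    functionalᶠ : ∀ {a b c c′} → a ·ᶠ b ⇓ c → a ·ᶠ b ⇓ c′ → c ≈ c′
    functionalᶠ (n , e , d , p) (n′ , e′ , d′ , p′) with <-cmp n n′
    ... | tri< n<n′ _ _ = T≈F⇒trivial (longer n<n′ p p′) _ _
    ... | tri> _ _ n′<n = T≈F⇒trivial (longer n′<n p′ p) _ _
    ... | tri≈ _ refl _ = pair-injectiveʳ (functional (proj₂ p)
        (resp ≈-refl (seq-cong (≈-refl ∷ prefix d′ d n λ j j<n →
                        ≈-sym (agree p p′ n ≤-refl ≤-refl j j<n)))
              ≈-refl (proj₂ p′)))

    respᶠ : ∀ {a a′ b b′ c c′} → a ≈ a′ → b ≈ b′ → c ≈ c′ → a ·ᶠ b ⇓ c → a′ ·ᶠ b′ ⇓ c′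
    respᶠ p q r (n , e , d , h , l) =
      n , e , d
      , (λ i i<n → proj₁ (h i i<n) , resp p (args i) ≈-refl (proj₂ (h i i<n)))
      , resp p (args n) (pair-cong ≈-refl r) l
      where
      args : ∀ k → seq (_ ∷ applyUpTo d k) ≈ seq (_ ∷ applyUpTo d k)
      args k = seq-cong (q ∷ prefix d d k λ _ _ → ≈-refl)

  structure : PAS
  structure = record
    { setoid = setoid ; _·_⇓_ = _·ᶠ_⇓_ ; resp = respᶠ ; functional = functionalᶠ }

-- 𝒜[f].  Its application only refers to that of 𝒜 and to the chosen coding, so k
-- and s are not needed to define it; 𝒜 need not be given as a full pca.
adjoin : {A : PAS} → Coding A → PartialFun (PAS.setoid A) → PAS
adjoin C f = Adjoin.structure C f

triangle : ℕ → ℕ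
triangle zero    = 0
triangle (suc n) = suc n + triangle n

cantor : ℕ → ℕ → ℕ
cantor x y = triangle (x + y) + y

code : List ℕ → ℕ
code []       = 0
code (x ∷ xs) = suc (cantor x (code xs))

uncantor : ℕ → ℕ × ℕ
uncantor zero    = 0 , 0
uncantor (suc n) = step (uncantor n)
  where
  step : ℕ × ℕ → ℕ × ℕ
  step (zero  , y) = suc y , 0
  step (suc x , y) = x , suc y

uncantor-cantor : ∀ x y → uncantor (cantor x y) ≡ (x , y)
uncantor-cantor x y = go (x + y) x y refl
  where
  go : ∀ s x y → x + y ≡ s → uncantor (triangle s + y) ≡ (x , y)
  go zero    zero    zero    refl = refl
  go (suc s) (suc x) zero    p
    rewrite +-identityʳ (s + triangle s) | +-comm s (triangle s)
          | go s 0 s refl | sym (suc-injective p) | +-identityʳ x = refl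
  go s       x       (suc y) p
    rewrite +-suc (triangle s) y | go s (suc x) y (trans (sym (+-suc x y)) p) = refl

-- decodeUpTo k n is correct for codes n ≤ k.
decodeUpTo : ℕ → ℕ → List ℕ
decodeUpTo zero    _       = []
decodeUpTo (suc k) zero    = []
decodeUpTo (suc k) (suc n) = proj₁ (uncantor n) ∷ decodeUpTo k (proj₂ (uncantor n))

decode : ℕ → List ℕ
decode n = decodeUpTo n n

decode-code : ∀ xs → decode (code xs) ≡ xs
decode-code xs = go xs (code xs) ≤-refl
  where
  go : ∀ xs k → code xs ≤ k → decodeUpTo k (code xs) ≡ xs
  go []       zero    _       = refl
  go []       (suc k) _       = refl
  go (x ∷ xs) (suc k) (s≤s p)
    rewrite uncantor-cantor x (code xs) =
      cong (x ∷_) (go xs k (≤-trans (m≤n+m (code xs) (triangle (x + code xs))) p))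

Baire : Set
Baire = ℕ → ℕ

Baireₛ : Setoid 0ℓ 0ℓ
Baireₛ = ℕ →-setoid ℕ

module Kleene where

  query : Baire → ℕ → ℕ → ℕ
  query β n k = code (n ∷ applyUpTo β k)

  infix 4 _·_⇓_
  _·_⇓_ : Baire → Baire → Baire → Set
  α · β ⇓ γ = ∀ n → ∃[ k ] (α (query β n k) ≡ suc (γ n))
                         × (∀ j → j < k → α (query β n j) ≡ 0)

  applyUpTo-cong : ∀ {α β : Baire} → α ≗ β → ∀ n → applyUpTo α n ≡ applyUpTo β n
  applyUpTo-cong p zero    = refl
  applyUpTo-cong p (suc n) = cong₂ _∷_ (p 0) (applyUpTo-cong (p ∘ suc) n)

  query-cong : ∀ {α α′ β β′ : Baire} → α ≗ α′ → β ≗ β′ →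
               ∀ n k → α′ (query β′ n k) ≡ α (query β n k)
  query-cong {α} p q n k =
    sym (trans (cong (λ l → α (code (n ∷ l))) (applyUpTo-cong q k)) (p _))

  resp : ∀ {α α′ β β′ γ γ′} → α ≗ α′ → β ≗ β′ → γ ≗ γ′ → α · β ⇓ γ → α′ · β′ ⇓ γ′
  resp p q r h n with h n
  ... | k , s , l =
    k , trans (query-cong p q n k) (trans s (cong suc (r n)))
      , λ j j<k → trans (query-cong p q n j) (l j j<k)

  functional : ∀ {α β γ γ′} → α · β ⇓ γ → α · β ⇓ γ′ → γ ≗ γ′
  functional h h′ n with h n | h′ n
  ... | k , s , l | k′ , s′ , l′ with <-cmp k k′
  ... | tri< k<k′ _ _ = contradiction (trans (sym (l′ k k<k′)) s) 0≢1+n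
  ... | tri≈ _ refl _ = suc-injective (trans (sym s) s′)
  ... | tri> _ _ k′<k = contradiction (trans (sym (l k′ k′<k)) s′) 0≢1+n

K₂ : PAS
K₂ = record
  { setoid = Baireₛ ; _·_⇓_ = Kleene._·_⇓_
  ; resp = λ {α} {α′} {β} {β′} → Kleene.resp {α} {α′} {β} {β′}
  ; functional = λ {α} {β} → Kleene.functional {α} {β} }

-- U is open in the product topology: every point of U has a basic
-- neighbourhood, given by fixing finitely many coordinates, inside U.
Open : Pred Baire 0ℓ → Set
Open U = ∀ α → α ∈ U → ∃[ is ] ∀ β → All (λ i → β i ≡ α i) is → β ∈ U

-- Continuity of the restriction f|V : V → ℕ^ℕ, V having the subspace topology.
-- V is not required to respect ≗; opens do automatically, so passing to the
-- ≗-closure of V makes no difference when f respects ≗.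
ContinuousOn : (Baire → Baire) → Pred Baire 0ℓ → Set₁
ContinuousOn f V =
  ∀ W → Open W → ∃[ U ] Open U × (∀ α → α ∈ V → (f α ∈ W ⇔ α ∈ U))

Image : Func Baireₛ Baireₛ → Pred Baire 0ℓ
Image F β = ∃[ α ] Func.to F α ≗ β

-- Countable, possibly finite: contained in the range of a sequence.
Countable : Pred Baire 0ℓ → Set
Countable P = Σ[ e ∈ (ℕ → Baire) ] ∀ β → β ∈ P → ∃[ n ] β ≗ e n

infix 4 _∈im_
_∈im_ : ℕ → Baire → Set
n ∈im α = ∃[ m ] α m ≡ n

-- Whether suc n lies in the image of α is undecidable, so S is a function only
-- classically.
S : ExcludedMiddle 0ℓ → Baire → Baire
S em α n = if does (em {suc n ∈im α}) then 0 else suc n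

S-func : ExcludedMiddle 0ℓ → Func Baireₛ Baireₛ
S-func em = record { to = S em ; cong = S-cong }
  where
  S-cong : ∀ {α β} → α ≗ β → S em α ≗ S em β
  S-cong p n = cong (if_then 0 else suc n)
    (does-⇔ (mk⇔ (λ (m , q) → m , trans (sym (p m)) q) (λ (m , q) → m , trans (p m) q)) em em)

-- Interactions with o oracles: ask i q t evaluates oracle i at q and continues
-- with t applied to the answer.
data Tree (o : ℕ) : Set where
  ret : ℕ → Tree o
  ask : Fin o → ℕ → (ℕ → Tree o) → Tree o

eval : ∀ {o} → Tree o → Vec Baire o → ℕ
eval (ret v)     ρ = v
eval (ask i q t) ρ = eval (t (Vec.lookup ρ i q)) ρ

private
  get : List ℕ → ℕ → Maybe ℕ
  get []       _       = nothing
  get (x ∷ xs) zero    = just x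
  get (x ∷ xs) (suc n) = get xs n

  get-applyUpTo : ∀ (f : Baire) k n →
    (get (applyUpTo f k) n ≡ nothing) ⊎ (get (applyUpTo f k) n ≡ just (f n))
  get-applyUpTo f zero    n       = inj₁ refl
  get-applyUpTo f (suc k) zero    = inj₂ refl
  get-applyUpTo f (suc k) (suc n) = get-applyUpTo (f ∘ suc) k n

  get-applyUpTo-< : ∀ (f : Baire) k n → n < k → get (applyUpTo f k) n ≡ just (f n)
  get-applyUpTo-< f (suc k) zero    _       = refl
  get-applyUpTo-< f (suc k) (suc n) (s≤s p) = get-applyUpTo-< (f ∘ suc) k n p

  -- Replace oracle 0 by a finite initial segment; the result is 0 if the
  -- segment is too short and the successor of the original result otherwise.
  spec : ∀ {o} → Tree (suc o) → List ℕ → Tree o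
  spec-ask : ∀ {o} → (ℕ → Tree (suc o)) → List ℕ → Maybe ℕ → Tree o
  spec (ret v)           l = ret (suc v)
  spec (ask zero q t)    l = spec-ask t l (get l q)
  spec (ask (suc i) q t) l = ask i q λ v → spec (t v) l
  spec-ask t l nothing  = ret 0
  spec-ask t l (just v) = spec (t v) l

  compile-at : ∀ {o} → (ℕ → Tree (suc o)) → List ℕ → Tree o
  compile-at φ []       = ret 0
  compile-at φ (n ∷ bs) = spec (φ n) bs

  compile : ∀ {o} → (ℕ → Tree (suc o)) → (ℕ → Tree o)
  compile φ m = compile-at φ (decode m)

  spec-sound : ∀ {o} (t : Tree (suc o)) β ρ k → let r = eval (spec t (applyUpTo β k)) ρ in
               (r ≡ 0) ⊎ (r ≡ suc (eval t (β ∷ ρ)))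
  spec-sound (ret v)           β ρ k = inj₂ refl
  spec-sound (ask zero q t)    β ρ k with get (applyUpTo β k) q | get-applyUpTo β k q
  ... | _ | inj₁ refl = inj₁ refl
  ... | _ | inj₂ refl = spec-sound (t (β q)) β ρ k
  spec-sound (ask (suc i) q t) β ρ k = spec-sound (t _) β ρ k

  spec-complete : ∀ {o} (t : Tree (suc o)) β ρ →
    ∃[ K ] ∀ k → K ≤ k → eval (spec t (applyUpTo β k)) ρ ≡ suc (eval t (β ∷ ρ))
  spec-complete (ret v) β ρ = 0 , λ _ _ → refl
  spec-complete (ask zero q t) β ρ with spec-complete (t (β q)) β ρ
  ... | K , h = suc q ⊔ K , λ k p →
    trans (cong (λ m → eval (spec-ask t (applyUpTo β k) m) ρ)
                (get-applyUpTo-< β k q (≤-trans (m≤m⊔n (suc q) K) p)))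
          (h k (≤-trans (m≤n⊔m (suc q) K) p))
  spec-complete (ask (suc i) q t) β ρ = spec-complete (t _) β ρ

  least : ∀ (g : Baire) v → (∀ k → (g k ≡ 0) ⊎ (g k ≡ suc v)) → ∀ K → g K ≡ suc v →
          ∃[ k ] (g k ≡ suc v) × (∀ j → j < k → g j ≡ 0)
  least g v h K p with h 0
  ... | inj₂ q = 0 , q , λ _ ()
  least g v h zero    p | inj₁ _ = 0 , p , λ _ ()
  least g v h (suc K) p | inj₁ q with least (g ∘ suc) v (h ∘ suc) K p
  ... | k , r , l = suc k , r , λ { zero _ → q ; (suc j) (s≤s j<k) → l j j<k }

  open PAS K₂

  compile-⇓ : ∀ {o} (φ : ℕ → Tree (suc o)) ρ β →
              (λ m → eval (compile φ m) ρ) · β ⇓ (λ n → eval (φ n) (β ∷ ρ))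
  compile-⇓ φ ρ β n with spec-complete (φ n) β ρ
  ... | K , h with least (λ k → eval (spec (φ n) (applyUpTo β k)) ρ) _
                         (spec-sound (φ n) β ρ) K (h K ≤-refl)
  ... | k , p , l = k , trans (eq k) p , λ j j<k → trans (eq j) (l j j<k)
    where
    eq : ∀ k → eval (compile φ (code (n ∷ applyUpTo β k))) ρ
             ≡ eval (spec (φ n) (applyUpTo β k)) ρ
    eq k = cong (λ l → eval (compile-at φ l) ρ) (decode-code (n ∷ applyUpTo β k))

  ⇓-value : ∀ {o} (φ : ℕ → Tree (suc o)) ρ β {γ} → (∀ n → eval (φ n) (β ∷ ρ) ≡ γ n) →
            (λ m → eval (compile φ m) ρ) · β ⇓ γ
  ⇓-value φ ρ β h = resp {a = λ m → eval (compile φ m) ρ} {b = β} (λ _ → refl) (λ _ → refl) h (compile-⇓ φ ρ β)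

  rep₁ : (ℕ → Tree 1) → Baire
  rep₁ φ m = eval (compile φ m) []

  rep₁-⇓ : ∀ φ a {c} → (∀ n → eval (φ n) (a ∷ []) ≡ c n) → rep₁ φ · a ⇓ c
  rep₁-⇓ φ a = ⇓-value φ [] a

  rep₂ : (ℕ → Tree 2) → Baire
  rep₂ φ = rep₁ (compile φ)

  rep₂-⇓ : ∀ φ a b {c} → (∀ n → eval (φ n) (b ∷ a ∷ []) ≡ c n) → rep₂ φ · a · b ⇓ c
  rep₂-⇓ φ a b h = _ , compile-⇓ (compile φ) [] a , ⇓-value φ (a ∷ []) b h

  rep₃ : (ℕ → Tree 3) → Baire
  rep₃ φ = rep₂ (compile φ)

  rep₃-⇓ : ∀ φ a b c {d} → (∀ n → eval (φ n) (c ∷ b ∷ a ∷ []) ≡ d n) → rep₃ φ · a · b · c ⇓ d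
  rep₃-⇓ φ a b c h =
    _ , (_ , compile-⇓ (compile (compile φ)) [] a , compile-⇓ (compile φ) (a ∷ []) b)
      , ⇓-value φ (b ∷ a ∷ []) c h

  casesTree : ℕ → Tree 3
  casesTree n = ask (suc (suc zero)) 0
    λ { zero → ask zero n ret ; (suc _) → ask (suc zero) n ret }

  pairAt : Baire → Baire → ℕ × ℕ → ℕ
  pairAt α β (zero  , m) = α m
  pairAt α β (suc _ , m) = β m

  pairTree : ℕ × ℕ → Tree 2
  pairTree (zero  , m) = ask (suc zero) m ret
  pairTree (suc _ , m) = ask zero m ret

  pairTree-eval : ∀ α β p → eval (pairTree p) (β ∷ α ∷ []) ≡ pairAt α β p
  pairTree-eval α β (zero  , m) = refl
  pairTree-eval α β (suc _ , m) = refl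

  pairAt-cong : ∀ {α α′ β β′} → α ≗ α′ → β ≗ β′ → ∀ p → pairAt α β p ≡ pairAt α′ β′ p
  pairAt-cong p q (zero  , m) = p m
  pairAt-cong p q (suc _ , m) = q m

  entry : List Baire → ℕ × ℕ → ℕ
  entry []       _           = 0
  entry (a ∷ as) (zero  , j) = a j
  entry (a ∷ as) (suc i , j) = entry as (i , j)

  seqᵏ : List Baire → Baire
  seqᵏ as zero    = length as
  seqᵏ as (suc m) = entry as (uncantor m)

  entry-cong : ∀ {as bs} → Pointwise _≗_ as bs → ∀ p → entry as p ≡ entry bs p
  entry-cong []       _           = refl
  entry-cong (p ∷ ps) (zero  , j) = p j
  entry-cong (p ∷ ps) (suc i , j) = entry-cong ps (i , j)

  length-cong : ∀ {as bs : List Baire} → Pointwise _≗_ as bs → length as ≡ length bs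
  length-cong []       = refl
  length-cong (_ ∷ ps) = cong suc (length-cong ps)

  seqᵏ-cong : ∀ {as bs} → Pointwise _≗_ as bs → seqᵏ as ≗ seqᵏ bs
  seqᵏ-cong ps zero    = length-cong ps
  seqᵏ-cong ps (suc m) = entry-cong ps (uncantor m)

  entry-lookup : ∀ as i n → entry as (toℕ i , n) ≡ lookup as i n
  entry-lookup (a ∷ as) zero    n = refl
  entry-lookup (a ∷ as) (suc i) n = entry-lookup as i n

  projTree : ℕ → Tree 2
  projTree n = ask zero 0 λ i → ask (suc zero) (suc (cantor i n)) ret

  appendAt : ℕ → Bool → ℕ × ℕ → Tree 2
  appendAt m e (i , j) = if e then ask zero j ret else ask (suc zero) (suc m) ret

  appendTree : ℕ → Tree 2
  appendTree zero    = ask (suc zero) 0 λ l → ret (suc l)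
  appendTree (suc m) = ask (suc zero) 0 λ l → appendAt m (proj₁ (uncantor m) ≡ᵇ l) (uncantor m)

  entry-∷ʳ : ∀ as b i j →
    (if i ≡ᵇ length as then b j else entry as (i , j)) ≡ entry (as ∷ʳ b) (i , j)
  entry-∷ʳ []       b zero    j = refl
  entry-∷ʳ []       b (suc i) j = refl
  entry-∷ʳ (a ∷ as) b zero    j = refl
  entry-∷ʳ (a ∷ as) b (suc i) j = entry-∷ʳ as b i j

  append-eval : ∀ as b n → eval (appendTree n) (b ∷ seqᵏ as ∷ []) ≡ seqᵏ (as ∷ʳ b) n
  append-eval as b zero    = sym (trans (length-++ as) (+-comm (length as) 1))
  append-eval as b (suc m) =
    trans (if-eval (proj₁ (uncantor m) ≡ᵇ length as)) (entry-∷ʳ as b _ _)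
    where
    if-eval : ∀ e → eval (appendAt m e (uncantor m)) (b ∷ seqᵏ as ∷ [])
            ≡ (if e then b (proj₂ (uncantor m)) else entry as (uncantor m))
    if-eval true  = refl
    if-eval false = refl

  component : ℕ → ℕ → Tree 1
  component i n = ask zero (cantor i n) ret

  headTree : (ℕ → ℕ) → ℕ → Tree 1
  headTree g _ = ask zero 0 (ret ∘ g)

  zeroTree : ℕ → Tree 1
  zeroTree _ = ask zero 0 λ { zero → ret 1 ; (suc _) → ret 0 }

-- Quantifying over all codings of K₂ is not vacuous.
K₂-coding : Coding K₂
K₂-coding = record
  { T = const 1 ; F = const 0 ; D = rep₃ casesTree
  ; D-T = λ a b → rep₃-⇓ casesTree _ a b λ _ → refl
  ; D-F = λ a b → rep₃-⇓ casesTree _ a b λ _ → refl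
  ; pair = λ α β → pairAt α β ∘ uncantor
  ; pair-cong = λ p q → pairAt-cong p q ∘ uncantor
  ; pairing = rep₂ (pairTree ∘ uncantor) , λ a b → rep₂-⇓ (pairTree ∘ uncantor) a b (pairTree-eval a b ∘ uncantor)
  ; fst = rep₁ (component 0) , λ a b → rep₁-⇓ (component 0) _
                        λ n → cong (pairAt a b) (uncantor-cantor 0 n)
  ; snd = rep₁ (component 1) , λ a b → rep₁-⇓ (component 1) _
                        λ n → cong (pairAt a b) (uncantor-cantor 1 n)
  ; numeral = const
  ; successor = rep₁ (headTree suc) , λ n → rep₁-⇓ (headTree suc) (const n) λ _ → refl
  ; predecessor = rep₁ (headTree pred) , λ n → rep₁-⇓ (headTree pred) (const n) λ _ → refl
  ; zero-test = rep₁ zeroTree , λ { zero → rep₁-⇓ zeroTree _ λ _ → refl ; (suc n) → rep₁-⇓ zeroTree _ λ _ → refl }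
  ; seq = seqᵏ
  ; seq-cong = seqᵏ-cong
  ; seq-len = rep₁ (headTree id) , λ as → rep₁-⇓ (headTree id) (seqᵏ as) λ _ → refl
  ; seq-proj = rep₂ projTree , λ as i → rep₂-⇓ projTree (seqᵏ as) (const (toℕ i)) λ n →
      trans (cong (entry as) (uncantor-cantor (toℕ i) n)) (entry-lookup as i n)
  ; append = rep₂ appendTree , λ as b → rep₂-⇓ appendTree (seqᵏ as) b (append-eval as b)
  }

{-# OPTIONS --safe #-}

-- (a) Build γ by finite approximation.  A condition fixes γ below a length and
-- decides, for all positive values up to a bound N, whether they occur in γ.
-- At stage i take the undecided value N + 1.  If no α ∈ Vᵢ omitting N + 1
-- satisfies the condition, then omitting N + 1 from γ keeps γ out of Vᵢ.  If
-- such an α exists, S α N = N + 1, and by continuity every β ∈ Vᵢ close to α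
-- omits N + 1, so following α for a while and then taking the value N + 1 keeps
-- γ out of Vᵢ.
--
-- (b) If r represents S in K₂[F], the answers of F in the dialogue on α are
-- given by a finite list of indices in an enumeration of im F.  For a fixed list,
-- S is a composite of applications in K₂, hence continuous, on those α whose
-- dialogue has these answers.  There are countably many lists, contradicting (a).

module Submission where

open import Defs
open Kleene using (query)
open import Level using (0ℓ)
open import Axiom.ExcludedMiddle using (ExcludedMiddle)
open import Data.Bool.Base using (if_then_else_)
open import Data.List.Base using (List; []; _∷_; _∷ʳ_; _++_; map; applyUpTo)
open import Data.List.Properties using (∷ʳ-++; ++-identityʳ)
open import Data.List.Relation.Binary.Pointwise.Base using (Pointwise; []; _∷_)
open import Data.List.Relation.Unary.All using (All; []; _∷_)
open import Data.Nat.Base using (ℕ; zero; suc; _≤_; _<_; _⊔_; z≤n; s≤s)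
open import Data.Nat.Properties
open import Data.Product.Base using (_×_; _,_; proj₁; proj₂; ∃-syntax; Σ-syntax)
open import Data.Sum.Base using (inj₁; inj₂)
open import Function.Base using (_∘_; const; id)
open import Function.Bundles using (Func; Equivalence)
open import Relation.Binary.Definitions using (tri<; tri≈; tri>)
open import Relation.Binary.PropositionalEquality
  using (_≡_; _≢_; _≗_; refl; sym; trans; cong; cong₂; subst)
open import Relation.Nullary.Decidable using (yes; no; dec-true; dec-false)
open import Relation.Nullary.Negation using (¬_; contradiction)
open import Relation.Unary using (Pred; Universal; ⋃; _∈_)

-- Continuity as local constancy of each coordinate

Agree : ℕ → Baire → Baire → Set
Agree K α β = ∀ i → i < K → β i ≡ α i

Agree-≤ : ∀ {J K α β} → J ≤ K → Agree K α β → Agree J α β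
Agree-≤ J≤K p i i<J = p i (<-≤-trans i<J J≤K)

LocallyConstantAt : (Baire → ℕ) → Pred Baire 0ℓ → Baire → Set
LocallyConstantAt g V α = ∃[ K ] ∀ β → β ∈ V → Agree K α β → g β ≡ g α

PointwiseContinuousOn : (Baire → Baire) → Pred Baire 0ℓ → Set
PointwiseContinuousOn f V = ∀ α → α ∈ V → ∀ n → LocallyConstantAt (λ β → f β n) V α

locallyConstant-below : ∀ {g : ℕ → Baire → ℕ} {V α} →
  (∀ j → LocallyConstantAt (g j) V α) → ∀ k →
  ∃[ K ] ∀ β → β ∈ V → Agree K α β → ∀ j → j < k → g j β ≡ g j α
locallyConstant-below c zero = 0 , λ _ _ _ _ ()
locallyConstant-below {g} {V} {α} c (suc k)
  with c 0 | locallyConstant-below {g ∘ suc} {V} {α} (c ∘ suc) k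
... | K , p | L , q = K ⊔ L , λ where
  β β∈V a zero    _         → p β β∈V (Agree-≤ {α = α} (m≤m⊔n K L) a)
  β β∈V a (suc j) (s≤s j<k) → q β β∈V (Agree-≤ {α = α} (m≤n⊔m K L) a) j j<k

agree-at : ∀ {α} (is : List ℕ) → ∃[ K ] ∀ β → Agree K α β → All (λ i → β i ≡ α i) is
agree-at []       = 0 , λ _ _ → []
agree-at {α} (i ∷ is) with agree-at {α} is
... | K , p = suc i ⊔ K , λ β a →
  a i (m≤m⊔n (suc i) K) ∷ p β (Agree-≤ {α = α} (m≤n⊔m (suc i) K) a)

pointwise : ∀ {f V} → ContinuousOn f V → PointwiseContinuousOn f V
-- The test set is the cylinder fixing the single coordinate `n` to be `f α n`.
pointwise {f} c α α∈V n with c (λ γ → γ n ≡ f α n) (λ γ p → n ∷ [] , λ { δ (q ∷ []) → trans q p })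
... | U , U-open , iff with U-open α (Equivalence.to (iff α α∈V) refl)
... | is , near with agree-at {α} is
... | K , p = K , λ β β∈V a → Equivalence.from (iff β β∈V) (near β (p β a))

-- Finite approximations and their limit

bounded-below : ∀ (α : Baire) K → ∃[ B ] ∀ i → i < K → α i ≤ B
bounded-below α zero    = 0 , λ _ ()
bounded-below α (suc K) with bounded-below (α ∘ suc) K
... | B , p = α 0 ⊔ B , λ where
  zero    _         → m≤m⊔n (α 0) B
  (suc i) (s≤s i<K) → ≤-trans (p i i<K) (m≤n⊔m (α 0) B)

-- The tail is 0 because conditions restrict positive values only.
follow : Baire → ℕ → ℕ → Baire
follow α K v i with <-cmp i K
... | tri< _ _ _ = α i
... | tri≈ _ _ _ = v
... | tri> _ _ _ = 0

follow-< : ∀ α K v i → i < K → follow α K v i ≡ α i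
follow-< α K v i i<K with <-cmp i K
... | tri< _ _ _   = refl
... | tri≈ i≮K _ _ = contradiction i<K i≮K
... | tri> i≮K _ _ = contradiction i<K i≮K

follow-≡ : ∀ α K v → follow α K v K ≡ v
follow-≡ α K v with <-cmp K K
... | tri< _ K≢K _ = contradiction refl K≢K
... | tri≈ _ _ _   = refl
... | tri> _ K≢K _ = contradiction refl K≢K

follow-≤ : ∀ α K v B → (∀ i → i < K → α i ≤ B) → v ≤ B → ∀ i → follow α K v i ≤ B
follow-≤ α K v B p v≤B i with <-cmp i K
... | tri< i<K _ _ = p i i<K
... | tri≈ _ _ _   = v≤B
... | tri> _ _ _   = z≤n

follow-im : ∀ α K v m → suc m ≢ v → suc m ∈im follow α K v → suc m ∈im α
follow-im α K v m m≢v (i , p) with <-cmp i K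
... | tri< _ _ _ = i , p
... | tri≈ _ _ _ = contradiction (sym p) m≢v
... | tri> _ _ _ = contradiction p 0≢1+n

-- Only the first `len` entries of `stem` are imposed, but its whole image says which positive
-- values up to `bound` are allowed. By `stem≤bound`, the value `suc bound` does not occur in
-- `stem`.
record Condition : Set where
  constructor condition
  field
    stem          : Baire
    len bound     : ℕ
    stem≤bound    : ∀ i → stem i ≤ bound

open Condition

-- The second clause is one-sided: values missing from `x` are forbidden, those present are merely
-- permitted.
Satisfies : Baire → ℕ → ℕ → Baire → Set
Satisfies x k N β = Agree k x β × (∀ m → m < N → suc m ∈im β → suc m ∈im x)

infix 4 _⊩_ _≼_
_⊩_ : Baire → Condition → Set
β ⊩ p = Satisfies (stem p) (len p) (bound p) β

record _≼_ (p q : Condition) : Set where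
  constructor extension
  field
    len-≤   : len p ≤ len q
    bound-≤ : bound p ≤ bound q
    stem-⊩  : stem q ⊩ p

⊩-≼ : ∀ {β p q} → p ≼ q → β ⊩ q → β ⊩ p
⊩-≼ (extension l b (a , c)) (a′ , c′) =
    (λ i i<k → trans (a′ i (<-≤-trans i<k l)) (a i i<k))
  , (λ m m<N h → c m m<N (c′ m (<-≤-trans m<N b) h))

≼-refl : ∀ {p} → p ≼ p
≼-refl = extension ≤-refl ≤-refl ((λ _ _ → refl) , λ _ _ h → h)

≼-trans : ∀ {p q r} → p ≼ q → q ≼ r → p ≼ r
≼-trans pq@(extension l b _) (extension l′ b′ s) =
  extension (≤-trans l l′) (≤-trans b b′) (⊩-≼ pq s)

module Limit (p : ℕ → Condition) (p-≼ : ∀ s → p s ≼ p (suc s))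
             (len-< : ∀ s → len (p s) < len (p (suc s))) where

  limit : Baire
  limit i = stem (p (suc i)) i

  ≼-mono : ∀ {s t} → s ≤ t → p s ≼ p t
  ≼-mono {t = zero}  z≤n = ≼-refl
  ≼-mono {t = suc t} s≤1+t with m≤n⇒m<n∨m≡n s≤1+t
  ... | inj₁ (s≤s s≤t) = ≼-trans (≼-mono s≤t) (p-≼ t)
  ... | inj₂ refl      = ≼-refl

  s≤len : ∀ s → s ≤ len (p s)
  s≤len zero    = z≤n
  s≤len (suc s) = ≤-<-trans (s≤len s) (len-< s)

  stem-limit : ∀ i t → suc i ≤ t → stem (p t) i ≡ limit i
  stem-limit i t i<t = proj₁ (_≼_.stem-⊩ (≼-mono i<t)) i (s≤len (suc i))

  -- Each clause concerns one index `i` at a time, and the stem at stage `s ⊔ suc i` satisfies `p s`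
  -- and already agrees with `limit` at `i`.
  limit-⊩ : ∀ s → limit ⊩ p s
  limit-⊩ s =
      (λ i i<k → trans (sym (stem-limit i (s ⊔ suc i) (m≤n⊔m s (suc i)))) (proj₁ (later i) i i<k))
    , (λ m m<N (i , q) →
        proj₂ (later i) m m<N (i , trans (stem-limit i (s ⊔ suc i) (m≤n⊔m s (suc i))) q))
    where
    later : ∀ i → stem (p (s ⊔ suc i)) ⊩ p s
    later i = _≼_.stem-⊩ (≼-mono (m≤m⊔n s (suc i)))

-- Diagonalization against a countable cover

module Diagonal (em : ExcludedMiddle 0ℓ) where

  S-∉ : ∀ α n → ¬ suc n ∈im α → S em α n ≡ suc n
  S-∉ α n h = cong (if_then 0 else suc n) (dec-false em h)

  S-∈ : ∀ α n → suc n ∈im α → S em α n ≡ 0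
  S-∈ α n h = cong (if_then 0 else suc n) (dec-true em h)

  avoid : ∀ {V} → PointwiseContinuousOn (S em) V → ∀ p →
          ∃[ q ] (p ≼ q) × (len p < len q) × (∀ β → β ⊩ q → ¬ β ∈ V)
  -- Since `x` never exceeds `N`, satisfying the bound `suc N` entails omitting the value `suc N`.
  avoid {V} c (condition x k N x≤N) with em {∃[ α ] α ∈ V × Satisfies x k (suc N) α}
  ... | no ∄α =
        condition x (suc k) (suc N) (λ i → m≤n⇒m≤1+n (x≤N i))
      , extension (n≤1+n k) (n≤1+n N) ((λ _ _ → refl) , λ _ _ h → h)
      , n<1+n k
      , λ β (a , b) β∈V → ∄α (β , β∈V , Agree-≤ {α = x} (n≤1+n k) a , b)
  ... | yes (α , α∈V , a , b) with c α α∈V N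
  ... | K , near with bounded-below α (K ⊔ k)
  ... | B , α≤B =
        -- `L` is at least `K`, for `near`, and at least `k`, to extend the old stem. The value
        -- `suc N` sits at position `L`, hence the length `suc L`.
        condition y (suc L) (B ⊔ suc N)
          (follow-≤ α L (suc N) _ (λ i i<L → ≤-trans (α≤B i i<L) (m≤m⊔n B (suc N))) (m≤n⊔m B (suc N)))
      , extension (<⇒≤ (s≤s k≤L)) (<⇒≤ (m≤n⊔m B (suc N)))
          ( (λ i i<k → trans (follow-< α L (suc N) i (<-≤-trans i<k k≤L)) (a i i<k))
          , (λ m m<N h → b m (m<n⇒m<1+n m<N)
               (follow-im α L (suc N) m (<⇒≢ m<N ∘ suc-injective) h)))
      , s≤s k≤L
      -- `S β N` is 0 because `suc N` occurs at `L`, yet closeness to `α` makes it `suc N`.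
      , λ β (a′ , _) β∈V → contradiction
          (trans (sym (S-∈ β N (L , trans (a′ L ≤-refl) (follow-≡ α L (suc N)))))
            (trans (near β β∈V λ i i<K →
                     let i<L = <-≤-trans i<K (m≤m⊔n K k)
                     in trans (a′ i (m<n⇒m<1+n i<L)) (follow-< α L (suc N) i i<L))
                   (S-∉ α N α∌1+N)))
          0≢1+n
    where
    L   = K ⊔ k
    k≤L = m≤n⊔m K k
    y   = follow α L (suc N)
    α∌1+N : ¬ suc N ∈im α
    α∌1+N h with b N ≤-refl h
    ... | i , xᵢ≡1+N = 1+n≰n (subst (_≤ N) xᵢ≡1+N (x≤N i))

  module Generic (V : ℕ → Pred Baire 0ℓ) (c : ∀ i → PointwiseContinuousOn (S em) (V i)) where

    stage : ℕ → Condition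
    stage zero    = condition (const 0) 0 0 (λ _ → z≤n)
    stage (suc i) = proj₁ (avoid (c i) (stage i))

    open Limit stage (λ i → proj₁ (proj₂ (avoid (c i) (stage i))))
                     (λ i → proj₁ (proj₂ (proj₂ (avoid (c i) (stage i)))))
      public

    limit-∉ : ∀ i → ¬ limit ∈ V i
    limit-∉ i = proj₂ (proj₂ (proj₂ (avoid (c i) (stage i)))) limit (limit-⊩ (suc i))

  no-countable-cover : ∀ (V : ℕ → Pred Baire 0ℓ) → Universal (⋃ ℕ V) →
                       ¬ (∀ i → PointwiseContinuousOn (S em) (V i))
  no-countable-cover V cover c with cover (Generic.limit V c)
  ... | i , γ∈Vᵢ = Generic.limit-∉ V c i γ∈Vᵢ

-- Continuity of application in Kleene's second model

open PAS K₂ using (_·_⇓_; resp)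

first-success : ∀ {g : ℕ → ℕ} {k k′ v v′} →
  (g k ≡ suc v) × (∀ j → j < k → g j ≡ 0) →
  (g k′ ≡ suc v′) × (∀ j → j < k′ → g j ≡ 0) → v ≡ v′
first-success {k = k} {k′} (p , z) (p′ , z′) with <-cmp k k′
... | tri< k<k′ _ _ = contradiction (trans (sym (z′ k k<k′)) p) 0≢1+n
... | tri≈ _ refl _ = suc-injective (trans (sym p) p′)
... | tri> _ _ k′<k = contradiction (trans (sym (z k′ k′<k)) p′) 0≢1+n

applyUpTo-cong-< : ∀ {f g : Baire} k → (∀ i → i < k → f i ≡ g i) → applyUpTo f k ≡ applyUpTo g k
applyUpTo-cong-< zero    p = refl
applyUpTo-cong-< (suc k) p =
  cong₂ _∷_ (p 0 (s≤s z≤n)) (applyUpTo-cong-< k λ i i<k → p (suc i) (s≤s i<k))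

const-continuous : ∀ {V} γ → PointwiseContinuousOn (const γ) V
const-continuous γ α α∈V n = 0 , λ _ _ _ → refl

id-continuous : ∀ {V} → PointwiseContinuousOn id V
id-continuous α α∈V n = suc n , λ β β∈V a → a n ≤-refl

-- The value at `n` depends on `k` entries of `ψ α` and `suc k` entries of `φ α`: the success at `k`
-- and all the failures before it, which keep `k` least.
app-continuous : ∀ {φ ψ χ V} → PointwiseContinuousOn φ V → PointwiseContinuousOn ψ V →
  (∀ α → α ∈ V → φ α · ψ α ⇓ χ α) → PointwiseContinuousOn χ V
app-continuous {φ} {ψ} {χ} {V} φ-c ψ-c app α α∈V n with app α α∈V n
... | k , success , failures
  with locallyConstant-below {α = α} (ψ-c α α∈V) k
     | locallyConstant-below {α = α} (φ-c α α∈V ∘ query (ψ α) n) (suc k)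
... | K , ψ-near | L , φ-near = K ⊔ L , λ β β∈V a →
  let same : ∀ j → j ≤ k → φ β (query (ψ β) n j) ≡ φ α (query (ψ α) n j)
      same j j≤k = trans
        (cong (λ l → φ β (code (n ∷ l))) (applyUpTo-cong-< j λ i i<j →
          ψ-near β β∈V (Agree-≤ {α = α} (m≤m⊔n K L) a) i (<-≤-trans i<j j≤k)))
        (φ-near β β∈V (Agree-≤ {α = α} (m≤n⊔m K L) a) j (s≤s j≤k))
  in first-success (proj₂ (app β β∈V n))
       ( trans (same k ≤-refl) success
       , λ j j<k → trans (same j (<⇒≤ j<k)) (failures j j<k))

-- Dialogues with a fixed list of answers

module _ (C : Coding K₂) where
  open Coding C

  seq-∷ʳ-continuous : ∀ {V} (as : Baire → List Baire) {b : Baire → Baire} →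
    PointwiseContinuousOn (seq ∘ as) V → PointwiseContinuousOn b V →
    PointwiseContinuousOn (λ α → seq (as α ∷ʳ b α)) V
  seq-∷ʳ-continuous as {b} as-c b-c =
    app-continuous (app-continuous (const-continuous (proj₁ append)) as-c
                      λ α _ → proj₁ (proj₂ (appended α)))
                   b-c λ α _ → proj₂ (proj₂ (appended α))
    where
    appended : ∀ α → ∃[ γ ] (proj₁ append · seq (as α) ⇓ γ) × (γ · b α ⇓ seq (as α ∷ʳ b α))
    appended α = proj₂ append (as α) (b α)

  -- The coding is arbitrary, so continuity comes from representability of `append`: the entries of
  -- `bs` are appended one by one.
  seq-∷-++-continuous : ∀ {V} as bs → PointwiseContinuousOn (λ α → seq (α ∷ as)) V →
                        PointwiseContinuousOn (λ α → seq (α ∷ as ++ bs)) V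
  seq-∷-++-continuous {V} as [] c =
    subst (λ l → PointwiseContinuousOn (λ α → seq (α ∷ l)) V) (sym (++-identityʳ as)) c
  seq-∷-++-continuous {V} as (b ∷ bs) c =
    subst (λ l → PointwiseContinuousOn (λ α → seq (α ∷ l)) V) (∷ʳ-++ as b bs)
      (seq-∷-++-continuous (as ∷ʳ b) bs (seq-∷ʳ-continuous (_∷ as) c (const-continuous b)))

  seq-∷-continuous : ∀ {V} bs → PointwiseContinuousOn (λ α → seq (α ∷ bs)) V
  seq-∷-continuous bs = seq-∷-++-continuous [] bs
    (seq-∷ʳ-continuous (const []) (const-continuous (seq [])) id-continuous)

  -- The last step of a dialogue in which the oracle answered as.
  Answered : (Baire → Baire) → Baire → List Baire → Pred Baire 0ℓ
  Answered f r as α = r · seq (α ∷ as) ⇓ pair T (f α)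

  -- Applying `r` and then `snd` recovers `f α` from the coded sequence.
  answered-continuous : ∀ f r as → PointwiseContinuousOn f (Answered f r as)
  answered-continuous f r as =
    app-continuous (const-continuous (proj₁ snd))
      (app-continuous (const-continuous r) (seq-∷-continuous as) λ _ h → h)
      λ α _ → proj₂ snd T (f α)

-- Countably many answer lists

module _ (P : Pred Baire 0ℓ) (enum : ℕ → Baire) (enumerates : ∀ β → β ∈ P → ∃[ n ] β ≗ enum n) where

  indices : ∀ (d : ℕ → Baire) n → (∀ i → i < n → d i ∈ P) →
            ∃[ l ] Pointwise _≗_ (applyUpTo d n) (map enum l)
  indices d zero    d∈P = [] , []
  indices d (suc n) d∈P with enumerates (d 0) (d∈P 0 (s≤s z≤n))
                           | indices (d ∘ suc) n (λ i i<n → d∈P (suc i) (s≤s i<n))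
  ... | m , p | l , ps = m ∷ l , p ∷ ps

theorem3p3 : (em : ExcludedMiddle 0ℓ) →
    (¬ (Σ[ V ∈ (ℕ → Pred Baire 0ℓ) ] Universal (⋃ ℕ V) × (∀ i → ContinuousOn (S em) (V i))))
    × ((C : Coding K₂) (F : Func Baireₛ Baireₛ) → Countable (Image F) →
    ¬ Representable (adjoin C (total F)) (total (S-func em)))
theorem3p3 em =
    (λ (V , cover , c) → no-countable-cover V cover (pointwise ∘ c))
  , λ C F (enum , enumerates) (r , represents) →
      let open Coding C using (seq-cong)
          V : ℕ → Pred Baire 0ℓ
          -- Every finite list of indices is `decode i` for some `i`, namely its code.
          V i = Answered C (S em) r (map enum (decode i))

          cover : Universal (⋃ ℕ V)
          cover α =
            let n , e , d , dialogue , output = represents α (S em α) (λ _ → refl)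
                l , d≗l = indices (Image F) enum enumerates d n λ i i<n → e i , proj₁ (dialogue i i<n)
            in code l , subst (λ l → Answered C (S em) r (map enum l) α) (sym (decode-code l))
                 (resp {a = r} (λ _ → refl) (seq-cong ((λ _ → refl) ∷ d≗l)) (λ _ → refl) output)
      in no-countable-cover V cover λ i → answered-continuous C (S em) r (map enum (decode i))
  where open Diagonal em
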